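{- Let $T_1$ be a plane tree with an even number $k$ of vertices, let $T_2$ be a plane tree with an even number $l$ of vertices, and let the plane tree $T$ be a sum of $T_1$ and $T_2$. Then $T$ is odd if and only if one of $T_1$, $T_2$ is odd and the other is even.
   Context: A plane tree is a finite tree embedded in the plane (equivalently, a tree with a cyclic counterclockwise order on the edges at each vertex). A plane tree $T$ is a sum of two plane trees $T_1$ and $T_2$ if after deletion of some edge of $T$ one obtains the disjoint union of $T_1$ and $T_2$ (with the induced plane structures). Parity: a pr-tree (plane rooted tree) is obtained from a plane tree by choosing a root vertex and a marked edge incident to the root. The children of each vertex are ordered from left to right: at the root, the edges are taken in counterclockwise order starting from the marked edge, and at any other vertex the edges to children are taken in counterclockwise order starting just after the edge to the parent. The bracket code of a pr-tree whose root has pr-subtrees $T_1',\dots,T_s'$ (left to right) is recursively $(\,c(T_1')\cdots c(T_s')\,)$, where $c(T_i')$ is the code of $T_i'$, and the one-vertex tree has code $()$. An inversion in a bracket code is a pair consisting of a closing bracket and an opening bracket, not necessarily adjacent, such that the closing bracket occurs before the opening bracket. A pr-tree is even if the number of inversions in its bracket code is even, and odd otherwise. For a plane tree with an even number of vertices this parity does not depend on the choice of root vertex and marked edge, so one speaks of even and odd plane trees. -}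

module Defs where

open import Data.Fin.Base using (Fin)
open import Data.Fin.Properties using (_≟_)
open import Data.List.Base using (List; []; _∷_; _++_; _∷ʳ_; map; filter; length)
open import Data.List.Membership.Propositional using (_∈_; _∉_)
open import Data.List.Relation.Binary.Pointwise.Base using (Pointwise)
open import Data.List.Relation.Unary.Linked using (Linked)
open import Data.List.Relation.Unary.Unique.Propositional using (Unique)
open import Data.Nat.Base using (ℕ; NonZero)
open import Data.Nat.Divisibility using (_∣_)
open import Data.Product.Base using (_×_; _,_; ∃; ∃₂)
open import Data.Sum.Base using (_⊎_; inj₁; inj₂; [_,_])
open import Function.Bundles using (_↔_; Inverse)
open import Relation.Binary.Construct.Closure.ReflexiveTransitive using (Star)
open import Relation.Binary.PropositionalEquality using (_≡_; refl)
open import Relation.Nullary using (¬_; Dec; yes; no; ¬?; _×-dec_; _⊎-dec_)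

-- Two lists present the same cyclic order when one is a cyclic shift of the
-- other.
_↻_ : {A : Set} → List A → List A → Set
xs ↻ ys = ∃₂ λ as bs → xs ≡ as ++ bs × ys ≡ bs ++ as

-- For each vertex, its neighbours in counterclockwise order. In a simple graph
-- the edges at v correspond to the neighbours of v. The entry at which a list
-- starts carries no information: lists are only ever used up to _↻_.
PlaneStructure : Set → Set
PlaneStructure V = V → List V

Adjacent : {V : Set} → PlaneStructure V → V → V → Set
Adjacent ρ u v = v ∈ ρ u

-- A simple closed walk u, v, w, … , u on at least three distinct vertices.
Cycle : {V : Set} → PlaneStructure V → Set
Cycle {V} ρ = ∃ λ (u : V) → ∃₂ λ v w → ∃ λ (vs : List V) →
  Unique (u ∷ v ∷ w ∷ vs) × Linked (Adjacent ρ) (u ∷ v ∷ w ∷ vs ∷ʳ u)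

record PlaneTree (n : ℕ) : Set where
  field
    nonEmpty  : NonZero n
    ccw       : PlaneStructure (Fin n)
    unique    : ∀ v → Unique (ccw v)
    loopless  : ∀ v → v ∉ ccw v
    symmetric : ∀ {u v} → Adjacent ccw u v → Adjacent ccw v u
    connected : ∀ u v → Star (Adjacent ccw) u v
    acyclic   : ¬ Cycle ccw

open PlaneTree public using (ccw)

_≅_ : {V W : Set} → PlaneStructure V → PlaneStructure W → Set
_≅_ {V} {W} ρ σ = ∃ λ (f : V ↔ W) →
  ∀ v → map (Inverse.to f) (ρ v) ↻ σ (Inverse.to f v)

deleteEdge : ∀ {n} → Fin n → Fin n → PlaneStructure (Fin n) → PlaneStructure (Fin n)
deleteEdge a b ρ v =
  filter (λ w → ¬? ((v ≟ a ×-dec w ≟ b) ⊎-dec (v ≟ b ×-dec w ≟ a))) (ρ v)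

_⊔_ : {V W : Set} → PlaneStructure V → PlaneStructure W → PlaneStructure (V ⊎ W)
ρ ⊔ σ = [ (λ v → map inj₁ (ρ v)) , (λ w → map inj₂ (σ w)) ]

IsSum : ∀ {m k l} → PlaneTree m → PlaneTree k → PlaneTree l → Set
IsSum T T₁ T₂ = ∃₂ λ a b →
  Adjacent (ccw T) a b × (deleteEdge a b (ccw T) ≅ (ccw T₁ ⊔ ccw T₂))

data PRTree : Set where
  node : List PRTree → PRTree

-- Branch ρ p v t: the vertex v together with its descendants, when p is the
-- parent of v, forms the pr-tree t.
data Branch {V : Set} (ρ : PlaneStructure V) (p v : V) : PRTree → Set where
  branch : ∀ {vs ts} → ρ v ↻ (p ∷ vs) → Pointwise (Branch ρ v) vs ts →
           Branch ρ p v (node ts)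

-- Rooting ρ r m t: choosing the root r and the marked edge from r to m yields
-- the pr-tree t. The one-vertex plane tree has no edge to mark, hence no rooting.
data Rooting {V : Set} (ρ : PlaneStructure V) (r m : V) : PRTree → Set where
  rooting : ∀ {vs ts} → ρ r ↻ (m ∷ vs) → Pointwise (Branch ρ r) (m ∷ vs) ts →
            Rooting ρ r m (node ts)

data Bracket : Set where
  opening closing : Bracket

mutual
  code : PRTree → List Bracket
  code (node ts) = opening ∷ codes ts ++ closing ∷ []

  codes : List PRTree → List Bracket
  codes []       = []
  codes (t ∷ ts) = code t ++ codes ts

-- All pairs (xᵢ , xⱼ) with i < j, listed with multiplicity.
orderedPairs : {A : Set} → List A → List (A × A)
orderedPairs []       = []
orderedPairs (x ∷ xs) = map (x ,_) xs ++ orderedPairs xs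

inversion? : (p : Bracket × Bracket) → Dec (p ≡ (closing , opening))
inversion? (closing , opening) = yes refl
inversion? (closing , closing) = no λ ()
inversion? (opening , _)       = no λ ()

inversions : List Bracket → ℕ
inversions w = length (filter inversion? (orderedPairs w))

EvenPR OddPR : PRTree → Set
EvenPR t = 2 ∣ inversions (code t)
OddPR  t = ¬ EvenPR t

-- Parity of a plane tree, read off from some choice of root and marked edge.
-- For an even number of vertices, all choices give the same parity.
EvenTree OddTree : ∀ {n} → PlaneTree n → Set
EvenTree T = ∃₂ λ r m → ∃ λ t → Rooting (ccw T) r m t × EvenPR t
OddTree  T = ∃₂ λ r m → ∃ λ t → Rooting (ccw T) r m t × OddPR t

{-# OPTIONS --safe #-}
module Submission where

-- In a plane tree with an even number of vertices, deleting an edge leaves two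
-- parts of equal parity; label the edge by that parity in ℤ/2. The labels
-- around each vertex then sum to 1, and on any branch the label of its stem is
-- its size mod 2. The inversions of the code of a pr-tree number, mod 2, the sum
-- over its vertices v of e₂ of the sizes of the subtrees at the children of v.
-- As the labels at v sum to 1, inserting the label of the edge to the parent
-- leaves e₂ unchanged, so the parity of any rooting is ∑ᵥ e₂(labels at v). For
-- a sum, label the deleted edge by 0: this changes none of the values e₂, so the
-- parities of the two summands add up.

open import Data.Fin.Base using (Fin; zero; suc; fromℕ<)
open import Data.Fin.Properties using (_≟_; injective⇒≤)
open import Data.List.Base using (List; []; _∷_; _++_; _∷ʳ_; map; filter; foldr; length; allFin; lookup)
open import Data.List.Membership.DecPropositional using (_∈?_)
open import Data.List.Membership.Propositional using (_∈_; _∉_)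
open import Data.List.Membership.Propositional.Properties
  using (∈-++⁺ˡ; ∈-++⁺ʳ; ∈-++⁻; ∈-∃++; ∈-map⁺; ∈-map⁻; ∈-allFin; ∈-lookup)
open import Data.List.Membership.Propositional.Properties.WithK using (unique∧set⇒bag)
open import Data.List.Properties using (filter-++; length-++; length-tabulate; map-++; map-∘; map-cong)
open import Data.List.Relation.Binary.BagAndSetEquality using (∼bag⇒↭)
open import Data.List.Relation.Binary.Disjoint.Propositional using (Disjoint)
open import Data.List.Relation.Binary.Permutation.Propositional
  using (_↭_; refl; prep; swap; trans; ↭-sym; ↭-reflexive; ↭⇒↭ₛ)
open import Data.List.Relation.Binary.Permutation.Propositional.Properties
  using (++-comm; shift; ∈-resp-↭; ↭-length)
  renaming (map⁺ to ↭-map⁺)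
open import Data.List.Relation.Binary.Permutation.Setoid.Properties using (foldr-commMonoid; Unique-resp-↭)
open import Data.List.Relation.Binary.Pointwise.Base using (Pointwise; []; _∷_)
open import Data.List.Relation.Unary.All as All using (All; []; _∷_)
open import Data.List.Relation.Unary.All.Properties using (++⁻ˡ; ¬Any⇒All¬)
open import Data.List.Relation.Unary.AllPairs using ([]; _∷_; tail)
open import Data.List.Relation.Unary.Any using (here; there)
open import Data.List.Relation.Unary.Linked using (Linked; []; [-]; _∷_)
open import Data.List.Relation.Unary.Unique.Propositional using (Unique)
open import Data.List.Relation.Unary.Unique.Propositional.Properties
  using (Unique[x∷xs]⇒x∉xs; allFin⁺)
  renaming (++⁺ to Unique-++⁺; map⁺ to Unique-map⁺)
open import Data.Nat.Base as ℕ using (ℕ; zero; suc; parity)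
open import Data.Nat.Divisibility using (_∣_; divides; ∣m∣n⇒∣m+n; ∣-refl; _∣0)
import Data.Nat.Properties as ℕₚ
open import Data.Nat.Solver using (module +-*-Solver)
open import Data.Parity.Base using (Parity; 0ℙ; 1ℙ; _+_; _*_)
open import Data.Parity.Properties
  using (+-assoc; +-comm; *-zeroʳ; +-homo-+; *-homo-*;
         +-0-isCommutativeMonoid; +-commutativeSemigroup)
open import Data.Product.Base using (_×_; _,_; ∃; ∃₂; proj₁; proj₂)
import Data.Product.Base as Product
open import Data.Sum.Base as Sum using (_⊎_; inj₁; inj₂; [_,_]; [_,_]′)
open import Data.Sum.Properties using (inj₁-injective; inj₂-injective)
open import Function.Base using (_∘_)
open import Function.Bundles using (_⇔_; mk⇔; Injection; Inverse)
open import Function.Properties.Inverse using (↔⇒↣)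
open import Relation.Binary.Construct.Closure.ReflexiveTransitive using (Star; ε; _◅_)
open import Relation.Binary.PropositionalEquality
  using (_≡_; _≢_; refl; sym; cong; cong₂; subst; setoid; module ≡-Reasoning)
import Relation.Binary.PropositionalEquality as ≡
open import Relation.Nullary using (¬_; Dec; yes; no; ¬?; _×-dec_; _⊎-dec_; contradiction)
open import Relation.Unary using (Decidable)
open import Algebra.Properties.CommutativeSemigroup +-commutativeSemigroup using (x∙yz≈y∙xz)
open import Defs

open ≡-Reasoning

-- Sums in ℤ/2

∑ : List Parity → Parity
∑ = foldr _+_ 0ℙ

-- The second elementary symmetric polynomial.
e₂ : List Parity → Parity
e₂ []       = 0ℙ
e₂ (p ∷ ps) = p * ∑ ps + e₂ ps

∑-++ : ∀ ps qs → ∑ (ps ++ qs) ≡ ∑ ps + ∑ qs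
∑-++ []       qs = refl
∑-++ (p ∷ ps) qs = ≡.trans (cong (p +_) (∑-++ ps qs)) (sym (+-assoc p (∑ ps) (∑ qs)))

∑-↭ : ∀ {ps qs} → ps ↭ qs → ∑ ps ≡ ∑ qs
∑-↭ = foldr-commMonoid (setoid Parity) +-0-isCommutativeMonoid ∘ ↭⇒↭ₛ

-- Both sides expand to pq + (p + q)s + r. Fixing `p` and `q` lets them compute to the same term
-- with `s` and `r` abstract.
e₂-swap : ∀ p q s r → p * (q + s) + (q * s + r) ≡ q * (p + s) + (p * s + r)
e₂-swap 0ℙ 0ℙ s r = refl
e₂-swap 0ℙ 1ℙ s r = refl
e₂-swap 1ℙ 0ℙ s r = refl
e₂-swap 1ℙ 1ℙ s r = refl

e₂-↭ : ∀ {ps qs} → ps ↭ qs → e₂ ps ≡ e₂ qs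
e₂-↭ refl = refl
e₂-↭ (prep p ps↭qs) = cong₂ (λ s r → p * s + r) (∑-↭ ps↭qs) (e₂-↭ ps↭qs)
e₂-↭ (swap {xs = ps} {ys = qs} p q ps↭qs) = begin
  p * (q + ∑ ps) + (q * ∑ ps + e₂ ps) ≡⟨ e₂-swap p q (∑ ps) (e₂ ps) ⟩
  q * (p + ∑ ps) + (p * ∑ ps + e₂ ps)
    ≡⟨ cong₂ (λ s r → q * (p + s) + (p * s + r)) (∑-↭ ps↭qs) (e₂-↭ ps↭qs) ⟩
  q * (p + ∑ qs) + (p * ∑ qs + e₂ qs) ∎
e₂-↭ (trans ps↭qs qs↭rs) = ≡.trans (e₂-↭ ps↭qs) (e₂-↭ qs↭rs)

p+q≡1⇒p*q≡0 : ∀ p q → p + q ≡ 1ℙ → p * q ≡ 0ℙ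
p+q≡1⇒p*q≡0 0ℙ q  _ = refl
p+q≡1⇒p*q≡0 1ℙ 0ℙ _ = refl

-- The difference is p times the sum of `ps`, and one of two elements of ℤ/2 with sum 1 is 0.
e₂-odd-∷ : ∀ p ps → ∑ (p ∷ ps) ≡ 1ℙ → e₂ (p ∷ ps) ≡ e₂ ps
e₂-odd-∷ p ps odd = cong (_+ e₂ ps) (p+q≡1⇒p*q≡0 p (∑ ps) odd)

∑≡1⇒∈ : {A : Set} {h : A → Parity} (xs : List A) → ∑ (map h xs) ≡ 1ℙ → ∃ (_∈ xs)
∑≡1⇒∈ (x ∷ _) _ = x , here refl

-- A counterpart of `filter` that keeps the entry with value 0, so that a label can be switched off
-- without shortening the neighbour list.
mask : {P : Set} → Dec P → Parity → Parity
mask (yes _) p = p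
mask (no  _) _ = 0ℙ

mask-cong : {P Q : Set} (P? : Dec P) (Q? : Dec Q) {p q : Parity} →
            (P → Q) → (Q → P) → p ≡ q → mask P? p ≡ mask Q? q
mask-cong (yes _)  (yes _)  _   _   p≡q = p≡q
mask-cong (yes p)  (no ¬q)  P⇒Q _   _   = contradiction (P⇒Q p) ¬q
mask-cong (no ¬p)  (yes q)  _   Q⇒P _   = contradiction (Q⇒P q) ¬p
mask-cong (no _)   (no _)   _   _   _   = refl

module _ {A : Set} {P : A → Set} (P? : Decidable P) (h : A → Parity) where

  ∑-mask : ∀ xs → ∑ (map (λ x → mask (P? x) (h x)) xs) ≡ ∑ (map h (filter P? xs))
  ∑-mask []       = refl
  ∑-mask (x ∷ xs) with P? x
  ... | yes _ = cong (h x +_) (∑-mask xs)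
  ... | no  _ = ∑-mask xs

  -- A zero entry kills every product in which it occurs, so zeroing an entry and dropping it have
  -- the same effect.
  e₂-mask : ∀ xs → e₂ (map (λ x → mask (P? x) (h x)) xs) ≡ e₂ (map h (filter P? xs))
  e₂-mask []       = refl
  e₂-mask (x ∷ xs) with P? x
  ... | yes _ = cong₂ (λ s r → h x * s + r) (∑-mask xs) (e₂-mask xs)
  ... | no  _ = e₂-mask xs

2∣⇒parity≡0 : ∀ {n} → 2 ∣ n → parity n ≡ 0ℙ
2∣⇒parity≡0 (divides q refl) = ≡.trans (*-homo-* q 2) (*-zeroʳ (parity q))

parity≡0⇒2∣ : ∀ n → parity n ≡ 0ℙ → 2 ∣ n
parity≡0⇒2∣ zero          _  = 2 ∣0
parity≡0⇒2∣ (suc (suc n)) eq = ∣m∣n⇒∣m+n ∣-refl (parity≡0⇒2∣ n eq)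

-- `parity` strips two successors at a time, so this does not hold by computation.
parity-suc : ∀ n → parity (suc n) ≡ 1ℙ + parity n
parity-suc = +-homo-+ 1

-- Inversions of bracket codes

openings closings : List Bracket → ℕ
openings []            = 0
openings (opening ∷ w) = suc (openings w)
openings (closing ∷ w) = openings w
closings []            = 0
closings (opening ∷ w) = closings w
closings (closing ∷ w) = suc (closings w)

openings-++ : ∀ u w → openings (u ++ w) ≡ openings u ℕ.+ openings w
openings-++ []            w = refl
openings-++ (opening ∷ u) w = cong suc (openings-++ u w)
openings-++ (closing ∷ u) w = openings-++ u w

closings-++ : ∀ u w → closings (u ++ w) ≡ closings u ℕ.+ closings w
closings-++ []            w = refl
closings-++ (opening ∷ u) w = closings-++ u w
closings-++ (closing ∷ u) w = cong suc (closings-++ u w)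

length-inversions-++ : ∀ ps qs → length (filter inversion? (ps ++ qs)) ≡
                       length (filter inversion? ps) ℕ.+ length (filter inversion? qs)
length-inversions-++ ps qs =
  ≡.trans (cong length (filter-++ inversion? ps qs)) (length-++ (filter inversion? ps))

inversions-opening : ∀ w → inversions (opening ∷ w) ≡ inversions w
inversions-opening w =
  ≡.trans (length-inversions-++ (map (opening ,_) w) (orderedPairs w))
          (cong (ℕ._+ inversions w) (none w))
  where
  none : ∀ w → length (filter inversion? (map (opening ,_) w)) ≡ 0
  none []      = refl
  none (_ ∷ w) = none w

inversions-closing : ∀ w → inversions (closing ∷ w) ≡ openings w ℕ.+ inversions w
inversions-closing w =
  ≡.trans (length-inversions-++ (map (closing ,_) w) (orderedPairs w))
          (cong (ℕ._+ inversions w) (all-openings w))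
  where
  all-openings : ∀ w → length (filter inversion? (map (closing ,_) w)) ≡ openings w
  all-openings []            = refl
  all-openings (opening ∷ w) = cong suc (all-openings w)
  all-openings (closing ∷ w) = all-openings w

-- Across the cut, every closing bracket of `u` forms an inversion with every opening bracket of
-- `w`.
inversions-++ : ∀ u w → inversions (u ++ w) ≡
                inversions u ℕ.+ inversions w ℕ.+ closings u ℕ.* openings w
inversions-++ [] w = sym (ℕₚ.+-identityʳ (inversions w))
inversions-++ (opening ∷ u) w
  rewrite inversions-opening (u ++ w) | inversions-opening u = inversions-++ u w
inversions-++ (closing ∷ u) w
  rewrite inversions-closing (u ++ w) | inversions-closing u
        | inversions-++ u w | openings-++ u w =
  solve 5 (λ o i o′ i′ c →
      (o :+ o′) :+ (i :+ i′ :+ c :* o′) := o :+ i :+ i′ :+ (o′ :+ c :* o′)) refl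
    (openings u) (inversions u) (openings w) (inversions w) (closings u)
  where open +-*-Solver

-- The outer opening bracket precedes everything and the outer closing bracket follows everything,
-- so neither occurs in an inversion.
inversions-node : ∀ ts → inversions (code (node ts)) ≡ inversions (codes ts)
inversions-node ts = begin
  inversions (opening ∷ codes ts ++ closing ∷ []) ≡⟨ inversions-opening (codes ts ++ closing ∷ []) ⟩
  inversions (codes ts ++ closing ∷ [])           ≡⟨ inversions-++ (codes ts) (closing ∷ []) ⟩
  inversions (codes ts) ℕ.+ 0 ℕ.+ closings (codes ts) ℕ.* 0
    ≡⟨ solve 2 (λ i c → i :+ con 0 :+ c :* con 0 := i) refl (inversions (codes ts)) (closings (codes ts)) ⟩
  inversions (codes ts) ∎
  where open +-*-Solver

size : PRTree → ℕ
size t = openings (code t)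

sizes : List PRTree → ℕ
sizes ts = openings (codes ts)

size-node : ∀ ts → size (node ts) ≡ suc (sizes ts)
size-node ts =
  cong suc (≡.trans (openings-++ (codes ts) (closing ∷ [])) (ℕₚ.+-identityʳ (sizes ts)))

sizes-∷ : ∀ t ts → sizes (t ∷ ts) ≡ size t ℕ.+ sizes ts
sizes-∷ t ts = openings-++ (code t) (codes ts)

mutual
  -- Codes are balanced. This turns the cross term of `inversions-++` into a product of sizes.
  closings-code : ∀ t → closings (code t) ≡ size t
  closings-code (node ts) = begin
    closings (codes ts ++ closing ∷ []) ≡⟨ closings-++ (codes ts) (closing ∷ []) ⟩
    closings (codes ts) ℕ.+ 1           ≡⟨ ℕₚ.+-comm _ 1 ⟩
    suc (closings (codes ts))           ≡⟨ cong suc (closings-codes ts) ⟩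
    suc (sizes ts)                      ≡⟨ size-node ts ⟨
    size (node ts)                      ∎

  closings-codes : ∀ ts → closings (codes ts) ≡ sizes ts
  closings-codes []       = refl
  closings-codes (t ∷ ts) = begin
    closings (code t ++ codes ts)              ≡⟨ closings-++ (code t) (codes ts) ⟩
    closings (code t) ℕ.+ closings (codes ts)  ≡⟨ cong₂ ℕ._+_ (closings-code t) (closings-codes ts) ⟩
    size t ℕ.+ sizes ts                        ≡⟨ sizes-∷ t ts ⟨
    sizes (t ∷ ts)                             ∎

parity-sizes-∷ : ∀ t ts → parity (sizes (t ∷ ts)) ≡ parity (size t) + parity (sizes ts)
parity-sizes-∷ t ts = ≡.trans (cong parity (sizes-∷ t ts)) (+-homo-+ (size t) (sizes ts))

parity-size-node : ∀ ts → parity (size (node ts)) ≡ 1ℙ + parity (sizes ts)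
parity-size-node ts = ≡.trans (cong parity (size-node ts)) (parity-suc (sizes ts))

-- The last summand counts the inversions between the first tree and the rest; summed along the
-- forest, these terms form `e₂` of the sizes.
parity-inversions-∷ : ∀ t ts → parity (inversions (codes (t ∷ ts))) ≡
  (parity (inversions (code t)) + parity (inversions (codes ts))) + (parity (size t) * parity (sizes ts))
parity-inversions-∷ t ts = begin
  parity (inversions (code t ++ codes ts))
    ≡⟨ cong parity (inversions-++ (code t) (codes ts)) ⟩
  parity (i ℕ.+ j ℕ.+ closings (code t) ℕ.* sizes ts)
    ≡⟨ cong (λ c → parity (i ℕ.+ j ℕ.+ c ℕ.* sizes ts)) (closings-code t) ⟩
  parity (i ℕ.+ j ℕ.+ size t ℕ.* sizes ts)
    ≡⟨ +-homo-+ (i ℕ.+ j) _ ⟩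
  parity (i ℕ.+ j) + parity (size t ℕ.* sizes ts)
    ≡⟨ cong₂ _+_ (+-homo-+ i j) (*-homo-* (size t) (sizes ts)) ⟩
  (parity i + parity j) + (parity (size t) * parity (sizes ts)) ∎
  where
  i = inversions (code t)
  j = inversions (codes ts)

-- Lists without repetition

module _ {A : Set} where

  Unique-↭ : {xs ys : List A} → xs ↭ ys → Unique xs → Unique ys
  Unique-↭ = Unique-resp-↭ (setoid A) ∘ ↭⇒↭ₛ

  Unique-++⁻ˡ : ∀ (xs : List A) {ys} → Unique (xs ++ ys) → Unique xs
  Unique-++⁻ˡ []       _         = []
  Unique-++⁻ˡ (x ∷ xs) (x∉ ∷ u) = ++⁻ˡ xs x∉ ∷ Unique-++⁻ˡ xs u

  -- Cuts a walk at a visit to `y`; when `y` is also the first vertex, the piece kept is a closed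
  -- walk as in `Cycle`.
  Linked-++⁻∷ʳ : ∀ {R : A → A → Set} xs {y ys} → Linked R (xs ++ y ∷ ys) → Linked R (xs ∷ʳ y)
  Linked-++⁻∷ʳ []           _       = [-]
  Linked-++⁻∷ʳ (_ ∷ [])     (r ∷ _) = r ∷ [-]
  Linked-++⁻∷ʳ (_ ∷ x ∷ xs) (r ∷ l) = r ∷ Linked-++⁻∷ʳ (x ∷ xs) l

  lookup-injective : ∀ {xs : List A} → Unique xs → ∀ {i j} → lookup xs i ≡ lookup xs j → i ≡ j
  lookup-injective (_ ∷ _)  {zero}  {zero}  _  = refl
  lookup-injective (x∉ ∷ _) {zero}  {suc j} eq = contradiction eq (All.lookup x∉ (∈-lookup j))
  lookup-injective (x∉ ∷ _) {suc i} {zero}  eq = contradiction (sym eq) (All.lookup x∉ (∈-lookup i))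
  lookup-injective (_ ∷ u)  {suc i} {suc j} eq = cong suc (lookup-injective u eq)

  -- An enumeration in an arbitrary order; any two are permutations of each other, so sums over them
  -- agree.
  Listing : List A → Set
  Listing xs = Unique xs × (∀ x → x ∈ xs)

  listings-↭ : ∀ {xs ys} → Listing xs → Listing ys → xs ↭ ys
  listings-↭ (xs! , ∈xs) (ys! , ∈ys) =
    ∼bag⇒↭ (unique∧set⇒bag xs! ys! (mk⇔ (λ _ → ∈ys _) (λ _ → ∈xs _)))

  ↻⇒↭ : ∀ {xs ys : List A} → xs ↻ ys → xs ↭ ys
  ↻⇒↭ (as , bs , refl , refl) = ++-comm as bs

unique-length≤ : ∀ {n} {xs : List (Fin n)} → Unique xs → length xs ℕ.≤ n
unique-length≤ xs! = injective⇒≤ (lookup-injective xs!)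

allFin-listing : ∀ n → Listing (allFin n)
allFin-listing n = allFin⁺ n , ∈-allFin

listing-length : ∀ {n} {xs : List (Fin n)} → Listing xs → length xs ≡ n
listing-length {n} xs! =
  ≡.trans (↭-length (listings-↭ xs! (allFin-listing n))) (length-tabulate (λ i → i))

-- Branches

module _ {V : Set} {ρ : PlaneStructure V} where

  mutual
    -- Read off from the derivation, because the pr-tree itself no longer names the vertices.
    vertices : ∀ {p v t} → Branch ρ p v t → List V
    vertices {v = v} (branch _ bs) = v ∷ forestVertices bs

    forestVertices : ∀ {v vs ts} → Pointwise (Branch ρ v) vs ts → List V
    forestVertices []       = []
    forestVertices (b ∷ bs) = vertices b ++ forestVertices bs

  mutual
    length-vertices : ∀ {p v t} (b : Branch ρ p v t) → length (vertices b) ≡ size t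
    length-vertices (branch {ts = ts} _ bs) =
      ≡.trans (cong suc (length-forestVertices bs)) (sym (size-node ts))

    length-forestVertices : ∀ {v vs ts} (bs : Pointwise (Branch ρ v) vs ts) →
                            length (forestVertices bs) ≡ sizes ts
    length-forestVertices [] = refl
    length-forestVertices (_∷_ {y = t} {ys = ts} b bs) = begin
      length (vertices b ++ forestVertices bs)               ≡⟨ length-++ (vertices b) ⟩
      length (vertices b) ℕ.+ length (forestVertices bs)
        ≡⟨ cong₂ ℕ._+_ (length-vertices b) (length-forestVertices bs) ⟩
      size t ℕ.+ sizes ts                                    ≡⟨ sizes-∷ t ts ⟨
      sizes (t ∷ ts)                                         ∎

  root∈vertices : ∀ {p v t} (b : Branch ρ p v t) → v ∈ vertices b
  root∈vertices (branch _ _) = here refl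

  roots∈forestVertices : ∀ {v vs ts} (bs : Pointwise (Branch ρ v) vs ts) →
                         ∀ {c} → c ∈ vs → c ∈ forestVertices bs
  roots∈forestVertices (b ∷ _)  (here refl) = ∈-++⁺ˡ (root∈vertices b)
  roots∈forestVertices (b ∷ bs) (there c∈)  = ∈-++⁺ʳ (vertices b) (roots∈forestVertices bs c∈)

  mutual
    -- The neighbours of a vertex of the branch are its children and its parent, and only the top
    -- vertex has its parent `p` as the way out.
    vertices-closed : ∀ {p v t} (b : Branch ρ p v t) {w u} →
                      w ∈ vertices b → Adjacent ρ w u → u ∈ vertices b ⊎ u ≡ p
    vertices-closed (branch rot bs) (here refl) w~u with ∈-resp-↭ (↻⇒↭ rot) w~u
    ... | here u≡p  = inj₂ u≡p
    ... | there u∈vs = inj₁ (there (roots∈forestVertices bs u∈vs))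
    vertices-closed (branch _ bs) (there w∈) w~u =
      inj₁ ([ there , here ]′ (forestVertices-closed bs w∈ w~u))

    forestVertices-closed : ∀ {v vs ts} (bs : Pointwise (Branch ρ v) vs ts) {w u} →
                            w ∈ forestVertices bs → Adjacent ρ w u → u ∈ forestVertices bs ⊎ u ≡ v
    forestVertices-closed (b ∷ bs) w∈ w~u with ∈-++⁻ (vertices b) w∈
    ... | inj₁ w∈b  = Sum.map₁ ∈-++⁺ˡ (vertices-closed b w∈b w~u)
    ... | inj₂ w∈bs = Sum.map₁ (∈-++⁺ʳ (vertices b)) (forestVertices-closed bs w∈bs w~u)

  -- A walk without backtracking, listed from its last vertex to its first.
  data Trail : List V → Set where
    edge   : ∀ {u v} → Adjacent ρ u v → Trail (u ∷ v ∷ [])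
    extend : ∀ {u v w ws} → Adjacent ρ u v → u ≢ w → Trail (v ∷ w ∷ ws) → Trail (u ∷ v ∷ w ∷ ws)

  trail-linked : ∀ {ws} → Trail ws → Linked (Adjacent ρ) ws
  trail-linked (edge u~v)         = u~v ∷ [-]
  trail-linked (extend u~v _ tr) = u~v ∷ trail-linked tr

  trail-head : ∀ {u v ws} → Trail (u ∷ v ∷ ws) → Adjacent ρ u v
  trail-head (edge u~v)       = u~v
  trail-head (extend u~v _ _) = u~v

  sprout : ∀ {v vs} → All (λ c → ∃ (Branch ρ v c)) vs → ∃ (Pointwise (Branch ρ v) vs)
  sprout []             = [] , []
  sprout ((t , b) ∷ bs) = Product.map (t ∷_) (b ∷_) (sprout bs)

-- Edge labellings

Label : Set → Set
Label V = V → V → Parity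

module _ {V : Set} (ρ : PlaneStructure V) (x : Label V) where

  -- Stating the parity formula for any such labels lets it serve both for branch sizes and for
  -- labels glued from two summands.
  record IsLabelling : Set where
    field
      x-sym : ∀ u v → x u v ≡ x v u
      x-odd : ∀ v → ∑ (map (x v) (ρ v)) ≡ 1ℙ

  localParity : V → Parity
  localParity v = e₂ (map (x v) (ρ v))

module _ {V : Set} {ρ : PlaneStructure V} {x : Label V} (x-labelling : IsLabelling ρ x) where

  open IsLabelling x-labelling

  private
    f : V → Parity
    f = localParity ρ x

    odd-around : ∀ {v vs} → ρ v ↻ vs → ∑ (map (x v) vs) ≡ 1ℙ
    odd-around {v} rot = ≡.trans (sym (∑-↭ (↭-map⁺ (x v) (↻⇒↭ rot)))) (x-odd v)

    1+q≡p : ∀ p q → p + q ≡ 1ℙ → 1ℙ + q ≡ p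
    1+q≡p 0ℙ 1ℙ _ = refl
    1+q≡p 1ℙ 0ℙ _ = refl

  mutual
    -- The labels are forced from the leaves upwards: those towards the children are known, and the
    -- total around `v` is 1.
    label≡size : ∀ {p v t} → Branch ρ p v t → parity (size t) ≡ x p v
    label≡size {p} {v} (branch {vs} {ts} rot bs) = begin
      parity (size (node ts))    ≡⟨ parity-size-node ts ⟩
      1ℙ + parity (sizes ts)     ≡⟨ cong (1ℙ +_) (labels≡sizes bs) ⟩
      1ℙ + ∑ (map (x v) vs)      ≡⟨ 1+q≡p (x v p) _ (odd-around rot) ⟩
      x v p                      ≡⟨ x-sym v p ⟩
      x p v                      ∎

    labels≡sizes : ∀ {v vs ts} → Pointwise (Branch ρ v) vs ts →
                   parity (sizes ts) ≡ ∑ (map (x v) vs)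
    labels≡sizes [] = refl
    labels≡sizes (_∷_ {y = t} {ys = ts} b bs) =
      ≡.trans (parity-sizes-∷ t ts) (cong₂ _+_ (label≡size b) (labels≡sizes bs))

  mutual
    branch-parity : ∀ {p v t} (b : Branch ρ p v t) →
                    parity (inversions (code t)) ≡ ∑ (map f (vertices b))
    branch-parity {p} {v} (branch {vs} {ts} rot bs) = begin
      parity (inversions (code (node ts)))                   ≡⟨ cong parity (inversions-node ts) ⟩
      parity (inversions (codes ts))                         ≡⟨ forest-parity bs ⟩
      e₂ (map (x v) vs) + ∑ (map f (forestVertices bs))
        -- Inserting the label of the edge to `p` is free since the labels around `v` sum to 1;
        -- afterwards the term no longer depends on which neighbour is the parent.
        ≡⟨ cong (_+ ∑ (map f (forestVertices bs))) (e₂-odd-∷ (x v p) (map (x v) vs) (odd-around rot)) ⟨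
      e₂ (map (x v) (p ∷ vs)) + ∑ (map f (forestVertices bs))
        ≡⟨ cong (_+ ∑ (map f (forestVertices bs))) (e₂-↭ (↭-map⁺ (x v) (↻⇒↭ rot))) ⟨
      f v + ∑ (map f (forestVertices bs))                    ∎

    -- The cross inversions `G` of the first tree with the others are exactly what its label adds to
    -- `e₂`.
    forest-parity : ∀ {v vs ts} (bs : Pointwise (Branch ρ v) vs ts) →
                    parity (inversions (codes ts)) ≡ e₂ (map (x v) vs) + ∑ (map f (forestVertices bs))
    forest-parity [] = refl
    forest-parity {v} (_∷_ {x = c} {y = t} {xs = vs} {ys = ts} b bs) = begin
      parity (inversions (codes (t ∷ ts)))
        ≡⟨ parity-inversions-∷ t ts ⟩
      (parity (inversions (code t)) + parity (inversions (codes ts))) + (parity (size t) * parity (sizes ts))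
        ≡⟨ cong₂ _+_ (cong₂ _+_ (branch-parity b) (forest-parity bs))
                     (cong₂ _*_ (label≡size b) (labels≡sizes bs)) ⟩
      (F + (E + Fs)) + G
        ≡⟨ +-comm (F + (E + Fs)) G ⟩
      G + (F + (E + Fs))
        ≡⟨ cong (G +_) (x∙yz≈y∙xz F E Fs) ⟩
      G + (E + (F + Fs))
        ≡⟨ +-assoc G E (F + Fs) ⟨
      (G + E) + (F + Fs)
        ≡⟨ cong ((G + E) +_) (∑-++ (map f (vertices b)) (map f (forestVertices bs))) ⟨
      (G + E) + ∑ (map f (vertices b) ++ map f (forestVertices bs))
        ≡⟨ cong (λ ps → (G + E) + ∑ ps) (map-++ f (vertices b) (forestVertices bs)) ⟨
      (G + E) + ∑ (map f (vertices b ++ forestVertices bs)) ∎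
      where
      F  = ∑ (map f (vertices b))
      Fs = ∑ (map f (forestVertices bs))
      E  = e₂ (map (x v) vs)
      G  = x v c * ∑ (map (x v) vs)

-- Rootings of plane trees

module _ {n : ℕ} (T : PlaneTree n) where

  open PlaneTree T using (unique; loopless; symmetric; connected; acyclic)

  private
    ρ = ccw T

  -- A repeated vertex would close a cycle, which has at least three vertices because there are no
  -- loops and no backtracking.
  trail-unique : ∀ {ws} → Trail {ρ = ρ} ws → Unique ws
  trail-unique (edge {u} u~v) = (u≢v ∷ []) ∷ [] ∷ []
    where u≢v = λ { refl → loopless u u~v }
  trail-unique (extend {u} {v} {w} {ws} u~v u≢w tr) =
    ((λ { refl → loopless u u~v }) ∷ u≢w ∷ ¬Any⇒All¬ ws u∉ws) ∷ vws!
    where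
    vws! = trail-unique tr
    u∉ws : u ∉ ws
    u∉ws u∈ws with as , bs , refl ← ∈-∃++ u∈ws =
      -- The cycle runs from `u` to its recurrence in `ws`. Moving that later `u` to the front makes
      -- the uniqueness of the shorter trail apply.
      acyclic (u , v , w , as ,
        Unique-++⁻ˡ (u ∷ v ∷ w ∷ as) (Unique-↭ (shift u (v ∷ w ∷ as) bs) vws!) ,
        Linked-++⁻∷ʳ (u ∷ v ∷ w ∷ as) (u~v ∷ trail-linked tr))

  -- As `ρ v` has no repetition, no child equals `p`, so stepping on to a child does not backtrack.
  child-trails : ∀ {p v vs ws} → ρ v ↻ (p ∷ vs) → Trail {ρ = ρ} (v ∷ p ∷ ws) →
                 All (λ c → Trail {ρ = ρ} (c ∷ v ∷ p ∷ ws)) vs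
  child-trails {v = v} rot tr = All.tabulate λ c∈ →
    extend (symmetric (∈-resp-↭ (↭-sym (↻⇒↭ rot)) (there c∈)))
           (λ { refl → Unique[x∷xs]⇒x∉xs (Unique-↭ (↻⇒↭ rot) (unique v)) c∈ })
           tr

  mutual
    -- The trail to `v` continues down to every vertex of the branch, and a trail never repeats a
    -- vertex.
    vertices-avoid : ∀ {p v t ws} (b : Branch ρ p v t) → Trail {ρ = ρ} (v ∷ p ∷ ws) →
                     ∀ {w} → w ∈ vertices b → w ∉ p ∷ ws
    vertices-avoid (branch _ _)    tr (here refl) = Unique[x∷xs]⇒x∉xs (trail-unique tr)
    vertices-avoid (branch rot bs) tr (there w∈) =
      forestVertices-avoid bs (child-trails rot tr) w∈ ∘ there

    forestVertices-avoid : ∀ {v vs ts ws} (bs : Pointwise (Branch ρ v) vs ts) →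
                           All (λ c → Trail {ρ = ρ} (c ∷ v ∷ ws)) vs →
                           ∀ {w} → w ∈ forestVertices bs → w ∉ v ∷ ws
    forestVertices-avoid (b ∷ bs) (tr ∷ trs) w∈ with ∈-++⁻ (vertices b) w∈
    ... | inj₁ w∈b  = vertices-avoid b tr w∈b
    ... | inj₂ w∈bs = forestVertices-avoid bs trs w∈bs

  root∉forestVertices : ∀ {v vs ts} (bs : Pointwise (Branch ρ v) vs ts) →
                        All (Adjacent ρ v) vs → v ∉ forestVertices bs
  root∉forestVertices bs adj v∈ =
    forestVertices-avoid bs (All.map (edge ∘ symmetric) adj) v∈ (here refl)

  module _ {S : Fin n → Set} {q : Fin n} (closed : ∀ {u v} → S u → Adjacent ρ u v → S v ⊎ v ≡ q) where

    mutual
      -- Edges lead out of `S` only to `q`; if `q` is not in the branch, then climbing from child to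
      -- parent stays in `S`.
      ascend : ∀ {p v t} (b : Branch ρ p v t) → q ∉ vertices b →
               ∀ {w} → w ∈ vertices b → S w → S v
      ascend (branch rot bs) q∉ (here refl) s = s
      ascend (branch rot bs) q∉ (there w∈)  s
        with c , c∈ , sc ← ascend-forest bs (q∉ ∘ there) w∈ s
        with closed sc (symmetric (∈-resp-↭ (↭-sym (↻⇒↭ rot)) (there c∈)))
      ... | inj₁ sv  = sv
      ... | inj₂ v≡q = contradiction (here (sym v≡q)) q∉

      ascend-forest : ∀ {v vs ts} (bs : Pointwise (Branch ρ v) vs ts) → q ∉ forestVertices bs →
                      ∀ {w} → w ∈ forestVertices bs → S w → ∃ λ c → c ∈ vs × S c
      ascend-forest (b ∷ bs) q∉ w∈ s with ∈-++⁻ (vertices b) w∈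
      ... | inj₁ w∈b  = _ , here refl , ascend b (q∉ ∘ ∈-++⁺ˡ) w∈b s
      ... | inj₂ w∈bs = Product.map₂ (Product.map₁ there)
                          (ascend-forest bs (q∉ ∘ ∈-++⁺ʳ (vertices b)) w∈bs s)

  -- From a common vertex one climbs to the root of another branch at v without
  -- leaving b, as b can only be left through v.
  branches-disjoint : ∀ {v u us t ts} (b : Branch ρ v u t) (bs : Pointwise (Branch ρ v) us ts) →
                      Unique (u ∷ us) → All (Adjacent ρ v) (u ∷ us) →
                      Disjoint (vertices b) (forestVertices bs)
  branches-disjoint {v} b bs (u∉ ∷ _) (v~u ∷ adj) (w∈b , w∈bs)
    with c , c∈ , c∈b ← ascend-forest {S = _∈ vertices b} (vertices-closed b) bs
                          (root∉forestVertices bs adj) w∈bs w∈b =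
    vertices-avoid b (extend (symmetric v~u) (All.lookup u∉ c∈) (edge (All.lookup adj c∈)))
                   c∈b (there (here refl))

  mutual
    vertices-unique : ∀ {p v t} (b : Branch ρ p v t) → Unique (vertices b)
    vertices-unique {v = v} (branch rot bs) =
      rooted-unique bs (tail (Unique-↭ (↻⇒↭ rot) (unique v)))
        (All.tabulate (∈-resp-↭ (↭-sym (↻⇒↭ rot)) ∘ there))

    forestVertices-unique : ∀ {v vs ts} (bs : Pointwise (Branch ρ v) vs ts) →
                            Unique vs → All (Adjacent ρ v) vs → Unique (forestVertices bs)
    forestVertices-unique [] _ _ = []
    forestVertices-unique (b ∷ bs) vs! adj =
      Unique-++⁺ (vertices-unique b) (forestVertices-unique bs (tail vs!) (All.tail adj))
                 (branches-disjoint b bs vs! adj)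

    rooted-unique : ∀ {v vs ts} (bs : Pointwise (Branch ρ v) vs ts) →
                    Unique vs → All (Adjacent ρ v) vs → Unique (v ∷ forestVertices bs)
    rooted-unique bs vs! adj =
      ¬Any⇒All¬ _ (root∉forestVertices bs adj) ∷ forestVertices-unique bs vs! adj

  -- For completeness, a path from `v` never leaves the list, as the branches can be left only to
  -- `v`, and connectedness provides a path to every vertex.
  rooted-listing : ∀ {v vs ts} (bs : Pointwise (Branch ρ v) vs ts) → ρ v ↭ vs →
                   Listing (v ∷ forestVertices bs)
  rooted-listing {v} bs perm =
    rooted-unique bs (Unique-↭ perm (unique v)) (All.tabulate (∈-resp-↭ (↭-sym perm))) ,
    λ w → reach (connected v w) (here refl)
    where
    reach : ∀ {u w} → Star (Adjacent ρ) u w → u ∈ v ∷ forestVertices bs → w ∈ v ∷ forestVertices bs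
    reach ε            u∈          = u∈
    reach (u~w ◅ path) (here refl) = reach path (there (roots∈forestVertices bs (∈-resp-↭ perm u~w)))
    reach (u~w ◅ path) (there u∈)  = reach path ([ there , here ]′ (forestVertices-closed bs u∈ u~w))

  rooted-size : ∀ {v vs ts} → Pointwise (Branch ρ v) vs ts → ρ v ↭ vs → suc (sizes ts) ≡ n
  rooted-size bs perm =
    ≡.trans (cong suc (sym (length-forestVertices bs))) (listing-length (rooted-listing bs perm))

  -- Existence of branches and rootings

  mutual
    -- Trails have at most `n` entries. Each step down moves one unit from `fuel` to `length ws`, so
    -- at fuel 0 the trail, with 2 + `length ws` entries, would be too long.
    grow : ∀ fuel {p v ws} → Trail {ρ = ρ} (v ∷ p ∷ ws) → n ℕ.≤ fuel ℕ.+ length ws → ∃ (Branch ρ p v)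
    grow zero {ws = ws} tr n≤ =
      contradiction (ℕₚ.≤-trans (unique-length≤ (trail-unique tr)) n≤) (ℕₚ.1+n≰n ∘ ℕₚ.≤-trans (ℕₚ.n≤1+n _))
    grow (suc fuel) {p} {v} {ws} tr n≤ with as , bs , eq ← ∈-∃++ (trail-head tr) =
      -- Cutting the cyclic order at `p` lists the children from just after the edge to the parent.
      let rot : ρ v ↻ (p ∷ bs ++ as)
          rot = as , p ∷ bs , eq , refl
          n≤′ = subst (n ℕ.≤_) (sym (ℕₚ.+-suc fuel (length ws))) n≤
      in Product.map node (branch rot) (sprout (grow-all fuel (child-trails rot tr) n≤′))

    grow-all : ∀ fuel {v ws vs} → All (λ c → Trail {ρ = ρ} (c ∷ v ∷ ws)) vs →
               n ℕ.≤ fuel ℕ.+ length ws → All (λ c → ∃ (Branch ρ v c)) vs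
    grow-all fuel []         n≤ = []
    grow-all fuel (tr ∷ trs) n≤ = grow fuel tr n≤ ∷ grow-all fuel trs n≤

  branchAlong : ∀ {v u} → Adjacent ρ v u → ∃ (Branch ρ v u)
  branchAlong v~u = grow n (edge (symmetric v~u)) (ℕₚ.m≤m+n n 0)

  rootingAt : ∀ {r m} → Adjacent ρ r m → ∃ (Rooting ρ r m)
  rootingAt {r} {m} r~m with as , bs , eq ← ∈-∃++ r~m =
    let rot : ρ r ↻ (m ∷ bs ++ as)
        rot = as , m ∷ bs , eq , refl
    in Product.map node (rooting rot)
         (sprout (All.tabulate (branchAlong ∘ ∈-resp-↭ (↭-sym (↻⇒↭ rot)))))

  -- At the root all neighbours are children, so no label has to be inserted. The right-hand side
  -- mentions neither `r` nor `m`: the parity is the same for all rootings.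
  rooting-parity : ∀ {x} → IsLabelling ρ x → ∀ {r m t} → Rooting ρ r m t →
                   parity (inversions (code t)) ≡ ∑ (map (localParity ρ x) (allFin n))
  rooting-parity {x} lab {r} {m} (rooting {vs} {ts} rot bs) = begin
    parity (inversions (code (node ts)))     ≡⟨ cong parity (inversions-node ts) ⟩
    parity (inversions (codes ts))           ≡⟨ forest-parity lab bs ⟩
    e₂ (map (x r) (m ∷ vs)) + ∑ (map f (forestVertices bs))
      ≡⟨ cong (_+ ∑ (map f (forestVertices bs))) (e₂-↭ (↭-map⁺ (x r) (↻⇒↭ rot))) ⟨
    ∑ (map f (r ∷ forestVertices bs))
      ≡⟨ ∑-↭ (↭-map⁺ f (listings-↭ (rooted-listing bs (↻⇒↭ rot)) (allFin-listing n))) ⟩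
    ∑ (map f (allFin n)) ∎
    where f = localParity ρ x

  -- The labelling by branch sizes

  adjacent? : ∀ u v → Dec (Adjacent ρ u v)
  adjacent? u v = _∈?_ _≟_ v (ρ u)

  -- The value 0 off the edges is a default that keeps the label symmetric.
  branchLabel : Label (Fin n)
  branchLabel u v with adjacent? u v
  ... | yes u~v = parity (size (proj₁ (branchAlong u~v)))
  ... | no  _   = 0ℙ

  -- The pr-tree is existential because the label uses the adjacency proof found by `adjacent?`,
  -- which is not definitionally the given one.
  branchLabel-adjacent : ∀ {u v} → Adjacent ρ u v →
                         ∃ λ t → Branch ρ u v t × branchLabel u v ≡ parity (size t)
  branchLabel-adjacent {u} {v} u~v with adjacent? u v
  ... | yes u~v′ = _ , proj₂ (branchAlong u~v′) , refl
  ... | no  u≁v  = contradiction u~v u≁v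

  branchLabel-nonadjacent : ∀ {u v} → ¬ Adjacent ρ u v → branchLabel u v ≡ 0ℙ
  branchLabel-nonadjacent {u} {v} u≁v with adjacent? u v
  ... | yes u~v = contradiction u~v u≁v
  ... | no  _   = refl

  branchLabels : ∀ {v vs} → All (Adjacent ρ v) vs →
    ∃ λ ts → Pointwise (Branch ρ v) vs ts × ∑ (map (branchLabel v) vs) ≡ parity (sizes ts)
  branchLabels [] = [] , [] , refl
  branchLabels (v~u ∷ adj) with t , b , eq ← branchLabel-adjacent v~u | ts , bs , eqs ← branchLabels adj =
    t ∷ ts , b ∷ bs , ≡.trans (cong₂ _+_ eq eqs) (sym (parity-sizes-∷ t ts))

  module _ (2∣n : 2 ∣ n) where

    private
      1+p≡0⇒p≡1 : ∀ p → 1ℙ + p ≡ 0ℙ → p ≡ 1ℙ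
      1+p≡0⇒p≡1 1ℙ _ = refl

      p+q≡1⇒p≡1+q : ∀ p q → p + q ≡ 1ℙ → p ≡ 1ℙ + q
      p+q≡1⇒p≡1+q 0ℙ 1ℙ _ = refl
      p+q≡1⇒p≡1+q 1ℙ 0ℙ _ = refl

    -- The branches around `v` hold all vertices but `v` itself, hence n - 1 of them.
    sizes-odd : ∀ {v vs ts} → Pointwise (Branch ρ v) vs ts → ρ v ↭ vs → parity (sizes ts) ≡ 1ℙ
    sizes-odd {ts = ts} bs perm = 1+p≡0⇒p≡1 (parity (sizes ts)) (begin
      1ℙ + parity (sizes ts)   ≡⟨ parity-suc (sizes ts) ⟨
      parity (suc (sizes ts))  ≡⟨ cong parity (rooted-size bs perm) ⟩
      parity n                 ≡⟨ 2∣⇒parity≡0 2∣n ⟩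
      0ℙ                       ∎)

    -- The branches in the two directions of an edge together contain all n vertices.
    branchLabel-sym : ∀ u v → branchLabel u v ≡ branchLabel v u
    branchLabel-sym u v = cases (adjacent? u v)
      where
      cases : Dec (Adjacent ρ u v) → branchLabel u v ≡ branchLabel v u
      cases (no u≁v) =
        ≡.trans (branchLabel-nonadjacent u≁v) (sym (branchLabel-nonadjacent (u≁v ∘ symmetric)))
      cases (yes u~v)
        with t , b , eq ← branchLabel-adjacent u~v
           | node ts , branch rot bs , eq′ ← branchLabel-adjacent (symmetric u~v) = begin
        branchLabel u v          ≡⟨ eq ⟩
        parity (size t)          ≡⟨ p+q≡1⇒p≡1+q _ _ t+ts-odd ⟩
        1ℙ + parity (sizes ts)   ≡⟨ parity-size-node ts ⟨
        parity (size (node ts))  ≡⟨ eq′ ⟨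
        branchLabel v u          ∎
        where
        t+ts-odd = ≡.trans (sym (parity-sizes-∷ t ts)) (sizes-odd (b ∷ bs) (↻⇒↭ rot))

    branchLabel-isLabelling : IsLabelling ρ branchLabel
    branchLabel-isLabelling = record
      { x-sym = branchLabel-sym
      ; x-odd = λ v → let ts , bs , eq = branchLabels {v} (All.tabulate (λ u∈ → u∈))
                      in ≡.trans eq (sizes-odd bs refl)
      }

    -- The labels around the vertex 0 sum to 1, whereas an empty sum is 0.
    hasEdge : ∃₂ (Adjacent ρ)
    hasEdge = v , ∑≡1⇒∈ (ρ v) (IsLabelling.x-odd branchLabel-isLabelling v)
      where v = fromℕ< (ℕ.>-nonZero⁻¹ n {{PlaneTree.nonEmpty T}})

    someRooting : ∃₂ λ r m → ∃ (Rooting ρ r m)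
    someRooting = Product.map₂ (Product.map₂ rootingAt) hasEdge

-- Sums of plane trees

module _ {k l m : ℕ} (T₁ : PlaneTree k) (T₂ : PlaneTree l) (T : PlaneTree m)
         (a b : Fin m) (T∖ab≅T₁⊔T₂ : deleteEdge a b (ccw T) ≅ (ccw T₁ ⊔ ccw T₂))
         {x₁ : Label (Fin k)} {x₂ : Label (Fin l)}
         (lab₁ : IsLabelling (ccw T₁) x₁) (lab₂ : IsLabelling (ccw T₂) x₂) where

  private
    module L₁ = IsLabelling lab₁
    module L₂ = IsLabelling lab₂

    iso   = proj₁ T∖ab≅T₁⊔T₂
    iso-↻ = proj₂ T∖ab≅T₁⊔T₂

    g : Fin m → Fin k ⊎ Fin l
    g = Inverse.to iso

    σ = ccw T₁ ⊔ ccw T₂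

  -- Repeats the test in `deleteEdge` verbatim, so that filtering by it gives the same list
  -- definitionally.
  kept? : ∀ v w → Dec (¬ ((v ≡ a × w ≡ b) ⊎ (v ≡ b × w ≡ a)))
  kept? v w = ¬? ((v ≟ a ×-dec w ≟ b) ⊎-dec (v ≟ b ×-dec w ≟ a))

  -- The disjoint union has no edge between the two parts, so 0 is a mere default there.
  unionLabel : Label (Fin k ⊎ Fin l)
  unionLabel (inj₁ u) (inj₁ v) = x₁ u v
  unionLabel (inj₂ u) (inj₂ v) = x₂ u v
  unionLabel _        _        = 0ℙ

  unionLabel-sym : ∀ u v → unionLabel u v ≡ unionLabel v u
  unionLabel-sym (inj₁ u) (inj₁ v) = L₁.x-sym u v
  unionLabel-sym (inj₁ _) (inj₂ _) = refl
  unionLabel-sym (inj₂ _) (inj₁ _) = refl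
  unionLabel-sym (inj₂ u) (inj₂ v) = L₂.x-sym u v

  union-labels₁ : ∀ v → map (unionLabel (inj₁ v)) (σ (inj₁ v)) ≡ map (x₁ v) (ccw T₁ v)
  union-labels₁ v = sym (map-∘ (ccw T₁ v))

  union-labels₂ : ∀ v → map (unionLabel (inj₂ v)) (σ (inj₂ v)) ≡ map (x₂ v) (ccw T₂ v)
  union-labels₂ v = sym (map-∘ (ccw T₂ v))

  unionLabel-odd : ∀ v → ∑ (map (unionLabel v) (σ v)) ≡ 1ℙ
  unionLabel-odd (inj₁ v) = ≡.trans (cong ∑ (union-labels₁ v)) (L₁.x-odd v)
  unionLabel-odd (inj₂ v) = ≡.trans (cong ∑ (union-labels₂ v)) (L₂.x-odd v)

  -- Both k and l being even, the deleted edge gets label 0.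
  sumLabel : Label (Fin m)
  sumLabel v w = mask (kept? v w) (unionLabel (g v) (g w))

  sumLabel-sym : ∀ v w → sumLabel v w ≡ sumLabel w v
  sumLabel-sym v w = mask-cong (kept? v w) (kept? w v) (_∘ flip) (_∘ flip) (unionLabel-sym (g v) (g w))
    where
    flip : ∀ {v w} → (v ≡ a × w ≡ b) ⊎ (v ≡ b × w ≡ a) → (w ≡ a × v ≡ b) ⊎ (w ≡ b × v ≡ a)
    flip = Sum.swap ∘ Sum.map Product.swap Product.swap

  -- The isomorphism preserves neighbour lists up to rotation; a permutation suffices because `∑`
  -- and `e₂` are symmetric.
  kept-labels-↭ : ∀ v → map (unionLabel (g v) ∘ g) (deleteEdge a b (ccw T) v) ↭ map (unionLabel (g v)) (σ (g v))
  kept-labels-↭ v = trans (↭-reflexive (map-∘ (deleteEdge a b (ccw T) v)))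
                          (↭-map⁺ (unionLabel (g v)) (↻⇒↭ (iso-↻ v)))

  sumLabel-isLabelling : IsLabelling (ccw T) sumLabel
  sumLabel-isLabelling = record
    { x-sym = sumLabel-sym
    ; x-odd = λ v → ≡.trans (∑-mask (kept? v) _ (ccw T v))
                      (≡.trans (∑-↭ (kept-labels-↭ v)) (unionLabel-odd (g v)))
    }

  sum-localParity : ∀ v → localParity (ccw T) sumLabel v ≡ localParity σ unionLabel (g v)
  sum-localParity v = ≡.trans (e₂-mask (kept? v) _ (ccw T v)) (e₂-↭ (kept-labels-↭ v))

  image-listing : Listing (map g (allFin m))
  image-listing = Unique-map⁺ (Injection.injective (↔⇒↣ iso)) (allFin⁺ m) ,
    λ w → subst (_∈ map g (allFin m)) (Inverse.strictlyInverseˡ iso w)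
                (∈-map⁺ g (∈-allFin (Inverse.from iso w)))

  union-listing : Listing (map inj₁ (allFin k) ++ map inj₂ (allFin l))
  union-listing =
    Unique-++⁺ (Unique-map⁺ inj₁-injective (allFin⁺ k)) (Unique-map⁺ inj₂-injective (allFin⁺ l)) disj ,
    [ (λ i → ∈-++⁺ˡ (∈-map⁺ inj₁ (∈-allFin i))) , (λ j → ∈-++⁺ʳ _ (∈-map⁺ inj₂ (∈-allFin j))) ]
    where
    disj : Disjoint (map inj₁ (allFin k)) (map inj₂ (allFin l))
    disj (v∈ , v∈′) with _ , _ , refl ← ∈-map⁻ inj₁ v∈ | _ , _ , () ← ∈-map⁻ inj₂ v∈′

  -- Through `g`, the vertices of `T` enumerate the disjoint union, whose vertices can be reordered
  -- to put those of `T₁` first.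
  ∑-localParity : ∑ (map (localParity (ccw T) sumLabel) (allFin m)) ≡
    ∑ (map (localParity (ccw T₁) x₁) (allFin k)) + ∑ (map (localParity (ccw T₂) x₂) (allFin l))
  ∑-localParity = begin
    ∑ (map (localParity (ccw T) sumLabel) (allFin m))  ≡⟨ cong ∑ (map-cong sum-localParity (allFin m)) ⟩
    ∑ (map (f ∘ g) (allFin m))                         ≡⟨ cong ∑ (map-∘ (allFin m)) ⟩
    ∑ (map f (map g (allFin m)))                       ≡⟨ ∑-↭ (↭-map⁺ f (listings-↭ image-listing union-listing)) ⟩
    ∑ (map f (map inj₁ (allFin k) ++ map inj₂ (allFin l)))
      ≡⟨ cong ∑ (map-++ f (map inj₁ (allFin k)) (map inj₂ (allFin l))) ⟩
    ∑ (map f (map inj₁ (allFin k)) ++ map f (map inj₂ (allFin l)))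
      ≡⟨ ∑-++ (map f (map inj₁ (allFin k))) _ ⟩
    ∑ (map f (map inj₁ (allFin k))) + ∑ (map f (map inj₂ (allFin l)))
      ≡⟨ cong₂ (λ ps qs → ∑ ps + ∑ qs)
           (≡.trans (sym (map-∘ (allFin k))) (map-cong (cong e₂ ∘ union-labels₁) (allFin k)))
           (≡.trans (sym (map-∘ (allFin l))) (map-cong (cong e₂ ∘ union-labels₂) (allFin l))) ⟩
    ∑ (map (localParity (ccw T₁) x₁) (allFin k)) + ∑ (map (localParity (ccw T₂) x₂) (allFin l)) ∎
    where f = localParity σ unionLabel

-- Even and odd trees, and the parity of a sum

EvenPR⇒parity : ∀ {t} → EvenPR t → parity (inversions (code t)) ≡ 0ℙ
EvenPR⇒parity = 2∣⇒parity≡0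

parity⇒EvenPR : ∀ {t} → parity (inversions (code t)) ≡ 0ℙ → EvenPR t
parity⇒EvenPR = parity≡0⇒2∣ _

OddPR⇒parity : ∀ {t} → OddPR t → parity (inversions (code t)) ≡ 1ℙ
OddPR⇒parity {t} odd with parity (inversions (code t)) in eq
... | 0ℙ = contradiction (parity⇒EvenPR {t} eq) odd
... | 1ℙ = refl

parity⇒OddPR : ∀ {t} → parity (inversions (code t)) ≡ 1ℙ → OddPR t
parity⇒OddPR {t} eq even with () ← ≡.trans (sym eq) (EvenPR⇒parity {t} even)

proposition4p1 : ∀ {k l m : ℕ} (T₁ : PlaneTree k) (T₂ : PlaneTree l) (T : PlaneTree m) →
    2 ∣ k → 2 ∣ l → IsSum T T₁ T₂ →
    OddTree T ⇔ ((OddTree T₁ × EvenTree T₂) ⊎ (EvenTree T₁ × OddTree T₂))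
proposition4p1 T₁ T₂ T 2∣k 2∣l (a , b , a~b , T∖ab≅T₁⊔T₂) = mk⇔ split join
  where
  lab₁ = branchLabel-isLabelling T₁ 2∣k
  lab₂ = branchLabel-isLabelling T₂ 2∣l

  π : PRTree → Parity
  π t = parity (inversions (code t))

  -- The three rootings are unrelated: each parity is a sum of local parities over all vertices,
  -- whatever root and edge were chosen.
  additive : ∀ {r m t r₁ m₁ t₁ r₂ m₂ t₂} →
             Rooting (ccw T) r m t → Rooting (ccw T₁) r₁ m₁ t₁ → Rooting (ccw T₂) r₂ m₂ t₂ →
             π t ≡ π t₁ + π t₂
  additive {t = t} {t₁ = t₁} {t₂ = t₂} R R₁ R₂ = begin
    π t          ≡⟨ rooting-parity T (sumLabel-isLabelling T₁ T₂ T a b T∖ab≅T₁⊔T₂ lab₁ lab₂) R ⟩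
    _            ≡⟨ ∑-localParity T₁ T₂ T a b T∖ab≅T₁⊔T₂ lab₁ lab₂ ⟩
    _            ≡⟨ cong₂ _+_ (rooting-parity T₁ lab₁ R₁) (rooting-parity T₂ lab₂ R₂) ⟨
    π t₁ + π t₂  ∎

  split : OddTree T → (OddTree T₁ × EvenTree T₂) ⊎ (EvenTree T₁ × OddTree T₂)
  split (_ , _ , t , R , odd)
    -- The hypothesis roots only `T`; the summands have rootings because `k` and `l` are even.
    with r₁ , m₁ , t₁ , R₁ ← someRooting T₁ 2∣k | r₂ , m₂ , t₂ , R₂ ← someRooting T₂ 2∣l
    with π t₁ in eq₁ | π t₂ in eq₂ | ≡.trans (sym (OddPR⇒parity {t} odd)) (additive R R₁ R₂)
  ... | 1ℙ | 0ℙ | _ = inj₁ ((_ , _ , _ , R₁ , parity⇒OddPR {t₁} eq₁) , (_ , _ , _ , R₂ , parity⇒EvenPR {t₂} eq₂))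
  ... | 0ℙ | 1ℙ | _ = inj₂ ((_ , _ , _ , R₁ , parity⇒EvenPR {t₁} eq₁) , (_ , _ , _ , R₂ , parity⇒OddPR {t₂} eq₂))
  ... | 0ℙ | 0ℙ | ()
  ... | 1ℙ | 1ℙ | ()

  join : (OddTree T₁ × EvenTree T₂) ⊎ (EvenTree T₁ × OddTree T₂) → OddTree T
  -- The deleted edge itself serves as the marked edge of `T`, with root `a`.
  join parts with t , R ← rootingAt T a~b = _ , _ , t , R , parity⇒OddPR {t} (odd parts)
    where
    odd : (OddTree T₁ × EvenTree T₂) ⊎ (EvenTree T₁ × OddTree T₂) → π t ≡ 1ℙ
    odd (inj₁ ((_ , _ , t₁ , R₁ , odd₁) , (_ , _ , t₂ , R₂ , even₂))) =
      ≡.trans (additive R R₁ R₂) (cong₂ _+_ (OddPR⇒parity {t₁} odd₁) (EvenPR⇒parity {t₂} even₂))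
    odd (inj₂ ((_ , _ , t₁ , R₁ , even₁) , (_ , _ , t₂ , R₂ , odd₂))) =
      ≡.trans (additive R R₁ R₂) (cong₂ _+_ (EvenPR⇒parity {t₁} even₁) (OddPR⇒parity {t₂} odd₂))
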